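{- Let $f(x)=\dfrac{1+x}{(1-x^{2})^{s/2}}=\sum_{k\ge0}a_kx^k/k!$, so that $a_{2k}=\dfrac{(2k)!}{k!}\,(s/2)_k$ and $a_{2k+1}=(2k+1)a_{2k}$, where $s$ is a parameter. Then for all $n\ge1$, $$\ddot H_n(f)=\det(a_{2i+j})_{0\le i,j\le n-1}=\Bigl(\prod_{k=1}^{n-1}(2k)!\Bigr)\prod_{j=1}^{n-1}\bigl(s+2j-2\bigr)^{\,n-j} =2^{\binom n2}\prod_{k=1}^{n-1}(2k)!\prod_{i=1}^{n-1}(s/2)_i .$$
   Context: $(\gamma)_m=\gamma(\gamma+1)\cdots(\gamma+m-1)$ is the Pochhammer symbol; empty products equal $1$. -}

module Defs where

open import Algebra.Bundles using (CommutativeRing)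
open import Algebra.Morphism.Structures using (module RingMorphisms)
open import Data.Fin.Base using (Fin; zero; suc; toℕ)
open import Data.Integer.Base using (+_)
open import Data.Nat.Base as ℕ using (ℕ; zero; suc; _!)
open import Data.Nat.Properties using (_!≢0)
open import Data.Rational.Base as ℚ using (ℚ)
open import Data.Vec.Functional using (Vector; removeAt)
open import Level using (Level; _⊔_)

record ℚ-Algebra (c ℓ : Level) : Set (Level.suc (c ⊔ ℓ)) where
  field
    commutativeRing : CommutativeRing c ℓ

  open CommutativeRing commutativeRing public
  open RingMorphisms ℚ.+-*-rawRing rawRing

  field
    ι                    : ℚ → Carrier
    ι-isRingHomomorphism : IsRingHomomorphism ι

module Over {c ℓ : Level} (A : ℚ-Algebra c ℓ) where

  open ℚ-Algebra A hiding (zero)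
  open import Algebra.Definitions.RawMonoid +-rawMonoid public
    using (sum) renaming (_×_ to _·_)
  open import Algebra.Definitions.RawMonoid *-rawMonoid public
    using () renaming (sum to product)
  open import Algebra.Properties.Semiring.Exp semiring public
    using (_^_)

  fromℕ : ℕ → Carrier
  fromℕ n = n · 1#

  infix 7 _/!_

  _/!_ : ℕ → ℕ → Carrier
  m /! k = ι ((+ m) ℚ./ (k !))
    where instance _ = k !≢0

  -- ∏[1⋯ m ] f = f 1 * f 2 * ⋯ * f m
  ∏[1⋯_] : ℕ → (ℕ → Carrier) → Carrier
  ∏[1⋯ m ] f = product {m} (λ i → f (suc (toℕ i)))

  pochhammer : Carrier → ℕ → Carrier
  pochhammer γ m = product {m} (λ i → γ + fromℕ (toℕ i))

  binomial : Carrier → ℕ → Carrier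
  binomial α k = (1 /! k) * product {k} (λ i → α - fromℕ (toℕ i))

  -- A formal power series is its sequence of coefficients: f k = [xᵏ] f.
  PowerSeries : Set c
  PowerSeries = ℕ → Carrier

  infixl 6 _⊕_
  infixl 7 _⊛_ _⊘_
  infix  8 ⊖_
  infixr 9 _⊛^_

  𝟙 : PowerSeries
  𝟙 zero    = 1#
  𝟙 (suc _) = 0#

  X : PowerSeries
  X zero    = 0#
  X (suc k) = 𝟙 k

  _⊕_ : PowerSeries → PowerSeries → PowerSeries
  (f ⊕ g) k = f k + g k

  ⊖_ : PowerSeries → PowerSeries
  (⊖ f) k = - f k

  _⊛_ : PowerSeries → PowerSeries → PowerSeries
  (f ⊛ g) n = sum {suc n} (λ k → f (toℕ k) * g (n ℕ.∸ toℕ k))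

  _⊛^_ : PowerSeries → ℕ → PowerSeries
  f ⊛^ zero  = 𝟙
  f ⊛^ suc k = f ⊛ (f ⊛^ k)

  -- Long division: the quotient q with q ⊛ g = f, for a divisor g with
  -- constant coefficient 1.
  _⊘_ : PowerSeries → PowerSeries → PowerSeries
  (f ⊘ g) zero    = f 0
  (f ⊘ g) (suc n) = ((λ k → f (suc k) - f 0 * g (suc k)) ⊘ g) n

  -- The binomial series (1 + u)^α = Σₖ binomial α k uᵏ, for u with constant
  -- coefficient 0; then uᵏ contributes to the coefficient of xⁿ only if k ≤ n.
  [1+_]^_ : PowerSeries → Carrier → PowerSeries
  ([1+ u ]^ α) n = sum {suc n} (λ k → binomial α (toℕ k) * (u ⊛^ toℕ k) n)

  -- The numbers aₖ in f = Σₖ aₖ xᵏ / k!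
  egfCoeff : PowerSeries → ℕ → Carrier
  egfCoeff f k = (k !) · f k

  Matrix : ℕ → Set c
  Matrix n = Vector (Vector Carrier n) n

  -- Laplace expansion along the first row.
  det : ∀ {n} → Matrix n → Carrier
  det {zero}  M = 1#
  det {suc n} M = sum {suc n} (λ j →
    ((- 1#) ^ toℕ j) * M zero j * det (λ i → removeAt (M (suc i)) j))

  Ḧ : ℕ → PowerSeries → Carrier
  Ḧ n f = det {n} (λ i j → egfCoeff f (2 ℕ.* toℕ i ℕ.+ toℕ j))

  -- (1 + x) / (1 - x²)^(s/2)
  fₛ : Carrier → PowerSeries
  fₛ s = (𝟙 ⊕ X) ⊘ [1+ ⊖ (X ⊛ X) ]^ (ι ℚ.½ * s)

module Submission where

-- The coefficients satisfy a (k + 1) = r k * a k with r (2m) = 2m + 1 and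
-- r (2m + 1) = s + 2m, and r (2i + j) = 2i + r j.  Hence
-- a (2i + j) = a (2i) * ∏_{m<j} (2i + r m): after the row factors a (2i) are
-- pulled out, the columns are monic polynomials of degree j in x_i = 2i, and
-- the determinant is the Vandermonde determinant of 0, 2, …, 2n - 2.  It is
-- evaluated by subtracting (x_0 + r j) times column j from column j + 1, which
-- turns the first row into (1, 0, …, 0) and leaves a factor x_i - x_0 in row i.
-- The coefficients themselves come from (1 - y)^(-t) * (1 - y)^t = 1 with
-- y = x² and t = s / 2.

open import Defs
open import Algebra.Bundles using (Monoid)
open import Algebra.Morphism.Structures using (module RingMorphisms)
open import Data.Empty using (⊥-elim)
open import Data.Fin.Base using (Fin; zero; suc; toℕ; fromℕ<; inject₁; punchIn; punchOut)
open import Data.Fin.Properties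
  using (_≟_; punchInᵢ≢i; punchIn-injective; punchIn-punchOut; suc-injective;
         toℕ<n; toℕ-fromℕ<; toℕ-inject₁; toℕ-injective)
open import Data.Integer.Base as ℤ using (+_)
import Data.Integer.Properties as ℤₚ
open import Data.Nat.Base as ℕ using (ℕ; zero; suc; _∸_; _≥_; _!; NonZero)
open import Data.Nat.Combinatorics using (_C_; nC1≡n; nCk+nC[k+1]≡[n+1]C[k+1])
import Data.Nat.Properties as ℕₚ
open import Data.Product.Base using (_×_; _,_; ∃; proj₁; proj₂)
open import Data.Rational.Base as ℚ using (½)
import Data.Rational.Properties as ℚₚ
open import Data.Rational.Unnormalised.Base as ℚᵘ using (mkℚᵘ; *≡*)
import Data.Rational.Unnormalised.Properties as ℚᵘₚ
open import Data.Sum.Base using (_⊎_; inj₁; inj₂)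
open import Data.Vec.Functional using (Vector; removeAt; updateAt)
open import Data.Vec.Functional.Properties using (updateAt-updates; updateAt-minimal)
open import Function.Base using (_∘_)
open import Level using (Level)
open import Relation.Nullary using (yes; no)
import Relation.Binary.PropositionalEquality.Core as ≡
open ≡ using (_≡_; _≢_)

-- Determinants: linearity, equal columns and column operations.

-- Needed for `det-adjacent`: deleting a column other than the two equal ones leaves these adjacent,
-- so the minor falls under the induction hypothesis.
punchIn-adjacent : ∀ {n} (j : Fin (suc (suc n))) (k : Fin (suc n)) →
  j ≢ inject₁ k → j ≢ suc k →
  ∃ λ k′ → punchIn j (inject₁ k′) ≡ inject₁ k × punchIn j (suc k′) ≡ suc k
punchIn-adjacent zero zero j≢k _ = ⊥-elim (j≢k ≡.refl)
punchIn-adjacent zero (suc k) _ _ = k , ≡.refl , ≡.refl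
punchIn-adjacent (suc zero) zero _ j≢1 = ⊥-elim (j≢1 ≡.refl)
punchIn-adjacent {suc n} (suc (suc j)) zero _ _ = zero , ≡.refl , ≡.refl
punchIn-adjacent {suc n} (suc j) (suc k) p q =
  let k′ , eq₁ , eq₂ = punchIn-adjacent j k (p ∘ ≡.cong suc) (q ∘ ≡.cong suc)
  in suc k′ , ≡.cong suc eq₁ , ≡.cong suc eq₂

module Determinant {c ℓ : Level} (A : ℚ-Algebra c ℓ) where

  open ℚ-Algebra A hiding (zero)
  open Over A
  open import Algebra.Properties.Ring ring using (-1*x≈-x)
  open import Algebra.Properties.Semiring.Sum semiring
    using (sum-cong-≋; sum-replicate-zero; ∑-distrib-+; *-distribˡ-sum)
  open import Algebra.Solver.Ring.NaturalCoefficients.Default commutativeSemiring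
    using (solve; _:=_; _:*_; _:+_)
  open import Relation.Binary.Reasoning.Setoid setoid

  sum-zero : ∀ {n} {t : Vector Carrier n} → (∀ i → t i ≈ 0#) → sum t ≈ 0#
  sum-zero {n} t≈0 = trans (sum-cong-≋ t≈0) (sum-replicate-zero n)

  -- The pattern of a Laplace expansion with two equal adjacent columns: their two terms cancel and
  -- all others vanish.
  sum-adjacent : ∀ {n} (t : Vector Carrier (suc n)) (k : Fin n) →
    t (inject₁ k) + t (suc k) ≈ 0# →
    (∀ j → j ≢ inject₁ k → j ≢ suc k → t j ≈ 0#) → sum t ≈ 0#
  sum-adjacent t zero pair rest = begin
    t zero + (t (suc zero) + sum (λ i → t (suc (suc i))))
      ≈⟨ +-assoc _ _ _ ⟨
    t zero + t (suc zero) + sum (λ i → t (suc (suc i)))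
      ≈⟨ +-cong pair (sum-zero (λ i → rest (suc (suc i)) (λ ()) (λ ()))) ⟩
    0# + 0#
      ≈⟨ +-identityˡ _ ⟩
    0# ∎
  sum-adjacent t (suc k) pair rest = trans
    (+-cong (rest zero (λ ()) (λ ()))
      (sum-adjacent (t ∘ suc) k pair
        (λ j p q → rest (suc j) (p ∘ suc-injective) (q ∘ suc-injective))))
    (+-identityˡ _)

  -- The two shortened vectors differ only in position `k`, where one keeps `v (suc k)` and the
  -- other `v (inject₁ k)`.
  removeAt-adjacent : ∀ {n} (v : Vector Carrier (suc n)) (k : Fin n) →
    v (inject₁ k) ≈ v (suc k) → ∀ j → removeAt v (inject₁ k) j ≈ removeAt v (suc k) j
  removeAt-adjacent v zero    eq zero    = sym eq
  removeAt-adjacent v zero    eq (suc j) = refl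
  removeAt-adjacent v (suc k) eq zero    = refl
  removeAt-adjacent v (suc k) eq (suc j) = removeAt-adjacent (v ∘ suc) k eq j

  signs-cancel : ∀ {p q} k → p ≈ q → ((- 1#) ^ k) * p + ((- 1#) ^ suc k) * q ≈ 0#
  signs-cancel {p} {q} k p≈q = begin
    e * p + (- 1# * e) * q  ≈⟨ +-cong (*-congˡ p≈q) (trans (*-assoc _ _ _) (-1*x≈-x _)) ⟩
    e * q - e * q           ≈⟨ -‿inverseʳ _ ⟩
    0#                      ∎
    where e = (- 1#) ^ k

  det-cong : ∀ {n} {M N : Matrix n} → (∀ i j → M i j ≈ N i j) → det M ≈ det N
  det-cong {zero}  M≈N = refl
  det-cong {suc n} M≈N = sum-cong-≋ λ j →
    *-cong (*-congˡ {(- 1#) ^ toℕ j} (M≈N zero j)) (det-cong (λ i l → M≈N (suc i) (punchIn j l)))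

  -- Term by term in the Laplace expansion: for `j = k` the entry splits and the minor does not see
  -- column `k`; for `j ≢ k` the entry is common and the minor is linear in its column
  -- `punchOut j≢k`, which is where column `k` has moved.
  det-linear : ∀ {n} (L M N : Matrix n) (k : Fin n) (x : Carrier) →
    (∀ i → L i k ≈ M i k + x * N i k) →
    (∀ i j → j ≢ k → L i j ≈ M i j × L i j ≈ N i j) →
    det L ≈ det M + x * det N
  det-linear {suc n} L M N k x colₖ cols = begin
    sum {suc n} (term L)
      ≈⟨ sum-cong-≋ split ⟩
    sum {suc n} (λ j → term M j + x * term N j)
      ≈⟨ ∑-distrib-+ {suc n} (term M) (λ j → x * term N j) ⟩
    sum {suc n} (term M) + sum {suc n} (λ j → x * term N j)
      ≈⟨ +-congˡ (*-distribˡ-sum {suc n} x (term N)) ⟨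
    det M + x * det N ∎
    where
    minor : Matrix (suc n) → Fin (suc n) → Carrier
    minor K j = det (λ i → removeAt (K (suc i)) j)

    term : Matrix (suc n) → Fin (suc n) → Carrier
    term K j = ((- 1#) ^ toℕ j) * K zero j * minor K j

    split : ∀ j → term L j ≈ term M j + x * term N j
    split j with j ≟ k
    ... | yes ≡.refl = begin
      e * L zero j * minor L j
        ≈⟨ *-congʳ (*-congˡ (colₖ zero)) ⟩
      e * (M zero j + x * N zero j) * minor L j
        ≈⟨ solve 5 (λ e m x n d → e :* (m :+ x :* n) :* d := e :* m :* d :+ x :* (e :* n :* d))
             refl e (M zero j) x (N zero j) (minor L j) ⟩
      e * M zero j * minor L j + x * (e * N zero j * minor L j)
        ≈⟨ +-cong (*-congˡ (det-cong (λ i l → proj₁ (cols (suc i) _ (punchInᵢ≢i j l)))))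
             (*-congˡ (*-congˡ (det-cong (λ i l → proj₂ (cols (suc i) _ (punchInᵢ≢i j l)))))) ⟩
      term M j + x * term N j ∎
      where e = (- 1#) ^ toℕ j
    ... | no j≢k = begin
      e * L zero j * minor L j
        ≈⟨ *-congˡ (det-linear _ _ _ (punchOut j≢k) x
             (λ i → ≡.subst (λ l → L (suc i) l ≈ M (suc i) l + x * N (suc i) l)
                      (≡.sym (punchIn-punchOut j≢k)) (colₖ (suc i)))
             (λ i l l≢ → cols (suc i) (punchIn j l)
                (λ eq → l≢ (punchIn-injective j l _ (≡.trans eq (≡.sym (punchIn-punchOut j≢k))))))) ⟩
      e * L zero j * (minor M j + x * minor N j)
        ≈⟨ solve 5 (λ e l m x n → e :* l :* (m :+ x :* n) := e :* l :* m :+ x :* (e :* l :* n))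
             refl e (L zero j) (minor M j) x (minor N j) ⟩
      e * L zero j * minor M j + x * (e * L zero j * minor N j)
        ≈⟨ +-cong (*-congʳ (*-congˡ (proj₁ (cols zero j j≢k))))
             (*-congˡ (*-congʳ (*-congˡ (proj₂ (cols zero j j≢k))))) ⟩
      term M j + x * term N j ∎
      where e = (- 1#) ^ toℕ j

  -- The two equal columns have equal entries, equal minors and opposite signs, and every other
  -- minor again has two equal adjacent columns. Adjacency is what makes the two minors agree
  -- without permuting columns.
  det-adjacent : ∀ {n} (M : Matrix (suc n)) (k : Fin n) →
    (∀ i → M i (inject₁ k) ≈ M i (suc k)) → det M ≈ 0#
  det-adjacent {suc n} M k eq = sum-adjacent term k pair rest
    where
    minor : Fin (suc (suc n)) → Carrier
    minor j = det (λ i → removeAt (M (suc i)) j)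

    term : Fin (suc (suc n)) → Carrier
    term j = ((- 1#) ^ toℕ j) * M zero j * minor j

    pair : term (inject₁ k) + term (suc k) ≈ 0#
    pair = trans
      (+-cong
        (trans (*-assoc _ _ _) (*-congʳ (reflexive (≡.cong ((- 1#) ^_) (toℕ-inject₁ k)))))
        (*-assoc _ _ _))
      (signs-cancel (toℕ k) (*-cong (eq zero)
        (det-cong (λ i j → removeAt-adjacent (M (suc i)) k (eq (suc i)) j))))

    rest : ∀ j → j ≢ inject₁ k → j ≢ suc k → term j ≈ 0#
    rest j p q with k′ , eq₁ , eq₂ ← punchIn-adjacent j k p q =
      trans (*-congˡ (det-adjacent (λ i → removeAt (M (suc i)) j) k′ (λ i → ≡.subst₂ (λ l r → M (suc i) l ≈ M (suc i) r)
        (≡.sym eq₁) (≡.sym eq₂) (eq (suc i))))) (zeroʳ _)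

  -- By linearity in column `suc k`, the determinants differ by `x * det N`, where `N` repeats
  -- column `k` of `M` in the next place.
  det-column-operation : ∀ {n} (L M : Matrix (suc n)) (k : Fin n) (x : Carrier) →
    (∀ i → L i (suc k) ≈ M i (suc k) + x * M i (inject₁ k)) →
    (∀ i j → j ≢ suc k → L i j ≈ M i j) → det L ≈ det M
  det-column-operation {n} L M k x colₖ cols = begin
    det L              ≈⟨ det-linear L M N (suc k) x
                            (λ i → trans (colₖ i) (+-congˡ (*-congˡ (sym (reflexive (N-new i))))))
                            (λ i j p → cols i j p , trans (cols i j p) (sym (reflexive (N-old i j p)))) ⟩
    det M + x * det N  ≈⟨ +-congˡ (trans (*-congˡ (det-adjacent N k N-adjacent)) (zeroʳ x)) ⟩
    det M + 0#         ≈⟨ +-identityʳ _ ⟩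
    det M              ∎
    where
    inject₁≢suc : ∀ {m} (i : Fin m) → inject₁ i ≢ suc i
    inject₁≢suc (suc i) = inject₁≢suc i ∘ suc-injective

    N : Matrix (suc n)
    N i = updateAt (M i) (suc k) (λ _ → M i (inject₁ k))

    N-new : ∀ i → N i (suc k) ≡ M i (inject₁ k)
    N-new i = updateAt-updates (suc k) (M i)

    N-old : ∀ i j → j ≢ suc k → N i j ≡ M i j
    N-old i j p = updateAt-minimal j (suc k) (M i) p

    N-adjacent : ∀ i → N i (inject₁ k) ≈ N i (suc k)
    N-adjacent i = reflexive (≡.trans (N-old i _ (inject₁≢suc k)) (≡.sym (N-new i)))

  det-row-scale : ∀ {n} (w : Vector Carrier n) (M : Matrix n) →
    det (λ i j → w i * M i j) ≈ product w * det M
  det-row-scale {zero}  w M = sym (*-identityˡ _)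
  det-row-scale {suc n} w M = begin
    sum {suc n} (λ j → e j * (w zero * M zero j) * det (λ i l → w (suc i) * M (suc i) (punchIn j l)))
      ≈⟨ sum-cong-≋ {suc n} (λ j → trans
           (*-congˡ (det-row-scale (w ∘ suc) (λ i → removeAt (M (suc i)) j)))
           (solve 5 (λ e w m p d → e :* (w :* m) :* (p :* d) := w :* p :* (e :* m :* d))
             refl (e j) (w zero) (M zero j) (product (w ∘ suc)) _)) ⟩
    sum {suc n} (λ j → product w * (e j * M zero j * det (λ i → removeAt (M (suc i)) j)))
      ≈⟨ *-distribˡ-sum {suc n} (product w) (λ j → e j * M zero j * det (λ i → removeAt (M (suc i)) j)) ⟨
    product w * det M ∎
    where
    e : Fin (suc n) → Carrier
    e j = (- 1#) ^ toℕ j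

  det-block : ∀ {n} (M : Matrix (suc n)) → M zero zero ≈ 1# →
    (∀ j → M zero (suc j) ≈ 0#) → det M ≈ det (λ i j → M (suc i) (suc j))
  det-block {n} M M₀₀ M₀ⱼ = begin
    1# * M zero zero * det (λ i j → M (suc i) (suc j)) + _
      ≈⟨ +-cong
           (trans (*-congʳ (trans (*-identityˡ _) M₀₀)) (*-identityˡ _))
           (sum-zero {n} (λ j → trans (*-congʳ (trans (*-congˡ (M₀ⱼ j)) (zeroʳ _))) (zeroˡ _))) ⟩
    det (λ i j → M (suc i) (suc j)) + 0#
      ≈⟨ +-identityʳ _ ⟩
    det (λ i j → M (suc i) (suc j)) ∎

-- The Vandermonde determinant in a Newton basis.

module Vandermonde {c ℓ : Level} (A : ℚ-Algebra c ℓ) where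

  open ℚ-Algebra A hiding (zero)
  open Over A
  open Determinant A
  open import Algebra.Solver.Ring.NaturalCoefficients.Default commutativeSemiring
    using (solve; _:=_; _:*_; _:+_)
  open import Relation.Binary.Reasoning.Setoid setoid

  -- u 0, …, u r, v r, v (r + 1), …
  splice : ℕ → (ℕ → Carrier) → (ℕ → Carrier) → ℕ → Carrier
  splice r       u v zero    = u 0
  splice zero    u v (suc j) = v j
  splice (suc r) u v (suc j) = splice r (u ∘ suc) (v ∘ suc) j

  splice-≤ : ∀ {r j} u v → j ℕ.≤ r → splice r u v j ≡ u j
  splice-≤ u v ℕ.z≤n       = ≡.refl
  splice-≤ u v (ℕ.s≤s j≤r) = splice-≤ (u ∘ suc) (v ∘ suc) j≤r

  splice-next : ∀ r u v → splice r u v (suc r) ≡ v r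
  splice-next zero    u v = ≡.refl
  splice-next (suc r) u v = splice-next r (u ∘ suc) (v ∘ suc)

  splice-step : ∀ r u v j → j ≢ suc r → splice (suc r) u v j ≡ splice r u v j
  splice-step r       u v zero          j≢ = ≡.refl
  splice-step zero    u v (suc zero)    j≢ with () ← j≢ ≡.refl
  splice-step zero    u v (suc (suc j)) j≢ = ≡.refl
  splice-step (suc r) u v (suc j)       j≢ = splice-step r (u ∘ suc) (v ∘ suc) j (j≢ ∘ ≡.cong suc)

  module _ {n : ℕ} (u v : Fin (suc n) → ℕ → Carrier) (r : ℕ → Carrier)
           (u-step : ∀ i j → u i (suc j) ≈ v i j + r j * u i j) where

    spliced : ℕ → Matrix (suc n)
    spliced m i j = splice m (u i) (v i) (toℕ j)

    -- The two matrices differ in column `suc k` alone, and by `u-step` the difference is `r k`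
    -- times column `k`. Columns are reduced from right to left, so that the left neighbour still
    -- holds the original `u i k`.
    spliced-suc : ∀ (k : Fin n) → det (spliced (suc (toℕ k))) ≈ det (spliced (toℕ k))
    spliced-suc k = det-column-operation (spliced (suc (toℕ k))) (spliced (toℕ k)) k (r (toℕ k))
      (λ i → begin
        splice (suc (toℕ k)) (u i) (v i) (suc (toℕ k))
          ≡⟨ splice-≤ (u i) (v i) (ℕₚ.≤-refl {suc (toℕ k)}) ⟩
        u i (suc (toℕ k))
          ≈⟨ u-step i (toℕ k) ⟩
        v i (toℕ k) + r (toℕ k) * u i (toℕ k)
          ≡⟨ ≡.cong₂ (λ a b → a + r (toℕ k) * b)
               (splice-next (toℕ k) (u i) (v i))
               (≡.trans (≡.cong (splice (toℕ k) (u i) (v i)) (toℕ-inject₁ k))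
                 (splice-≤ (u i) (v i) (ℕₚ.≤-refl {toℕ k}))) ⟨
        splice (toℕ k) (u i) (v i) (suc (toℕ k))
          + r (toℕ k) * splice (toℕ k) (u i) (v i) (toℕ (inject₁ k)) ∎)
      (λ i j j≢ → reflexive (splice-step (toℕ k) (u i) (v i) (toℕ j) (j≢ ∘ toℕ-injective)))

    spliced-zero : ∀ m → m ℕ.≤ n → det (spliced m) ≈ det (spliced 0)
    spliced-zero zero    _   = refl
    spliced-zero (suc m) m<n = trans
      (≡.subst (λ l → det (spliced (suc l)) ≈ det (spliced l)) (toℕ-fromℕ< m<n)
        (spliced-suc (fromℕ< m<n)))
      (spliced-zero m (ℕₚ.<⇒≤ m<n))

    -- The reduced matrix is the original one times the unitriangular bidiagonal matrix with entries
    -- `- r j` above the diagonal. The chain runs from `spliced n`, where nothing is reduced, down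
    -- to `spliced 0`.
    det-bidiagonal : det (λ i j → u i (toℕ j)) ≈ det (spliced 0)
    det-bidiagonal = trans
      (det-cong (λ i j → sym (reflexive (splice-≤ (u i) (v i) (ℕ.s≤s⁻¹ (toℕ<n j))))))
      (spliced-zero n ℕₚ.≤-refl)

  module _ (r : ℕ → Carrier) where

    -- The Newton basis polynomials with nodes `- r 0`, `- r 1`, ..., evaluated at `x`.
    newton : Carrier → ℕ → Carrier
    newton x zero    = 1#
    newton x (suc j) = (x + r j) * newton x j

    newton-cong : ∀ {x y} → x ≈ y → ∀ j → newton x j ≈ newton y j
    newton-cong x≈y zero    = refl
    newton-cong x≈y (suc j) = *-cong (+-congʳ x≈y) (newton-cong x≈y j)

    -- Since `(x i + r j) - (x 0 + r j) = d i`, the reduced column `j + 1` is `d i` times the old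
    -- column `j`; so the block that remains has the same shape, with the point `x 0` dropped.
    -- Passing the differences as `d` keeps the computation free of subtraction.
    det-newton-suc : ∀ n (x d : ℕ → Carrier) → (∀ i → x i ≈ x 0 + d i) → d 0 ≈ 0# →
      det {suc n} (λ i j → newton (x (toℕ i)) (toℕ j))
        ≈ product {n} (λ i → d (suc (toℕ i)))
          * det {n} (λ i j → newton (x (suc (toℕ i))) (toℕ j))
    det-newton-suc n x d x≈ d₀ = begin
      det {suc n} (λ i j → newton (x (toℕ i)) (toℕ j))
        ≈⟨ det-bidiagonal u v (λ j → x 0 + r j) u-step ⟩
      det {suc n} (λ i j → splice 0 (u i) (v i) (toℕ j))
        ≈⟨ det-block (λ i j → splice 0 (u i) (v i) (toℕ j)) refl (λ j → trans (*-congʳ d₀) (zeroˡ _)) ⟩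
      det {n} (λ i j → d (suc (toℕ i)) * newton (x (suc (toℕ i))) (toℕ j))
        ≈⟨ det-row-scale {n} (λ i → d (suc (toℕ i))) _ ⟩
      product {n} (λ i → d (suc (toℕ i)))
        * det {n} (λ i j → newton (x (suc (toℕ i))) (toℕ j)) ∎
      where
      u v : Fin (suc n) → ℕ → Carrier
      u i = newton (x (toℕ i))
      v i j = d (toℕ i) * newton (x (toℕ i)) j

      u-step : ∀ i j → u i (suc j) ≈ v i j + (x 0 + r j) * u i j
      u-step i j = trans (*-congʳ (+-congʳ (x≈ (toℕ i))))
        (solve 4 (λ a d r u → (a :+ d :+ r) :* u := d :* u :+ (a :+ r) :* u)
          refl (x 0) (d (toℕ i)) (r j) (newton (x (toℕ i)) j))

-- Fractions, iterated sums and parity.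

/-≡ : ∀ {m n p q} .{{_ : NonZero n}} .{{_ : NonZero q}} →
  m ℕ.* q ≡ p ℕ.* n → (+ m) ℚ./ n ≡ (+ p) ℚ./ q
/-≡ {m} {suc n} {p} {suc q} eq = ℚₚ.fromℚᵘ-cong {mkℚᵘ (+ m) n} {mkℚᵘ (+ p) q}
  (*≡* (≡.trans (≡.sym (ℤₚ.pos-* m (suc q))) (≡.trans (≡.cong +_ eq) (ℤₚ.pos-* p (suc n)))))

/-suc : ∀ m n .{{_ : NonZero n}} → (+ suc m) ℚ./ n ≡ (+ 1) ℚ./ n ℚ.+ (+ m) ℚ./ n
/-suc m (suc n) = ℚₚ.toℚᵘ-injective (begin
  ℚ.toℚᵘ (ℚ.fromℚᵘ (mkℚᵘ (+ suc m) n))     ≈⟨ ℚₚ.toℚᵘ-fromℚᵘ (mkℚᵘ (+ suc m) n) ⟩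
  mkℚᵘ (+ suc m) n                         ≈⟨ *≡* numerators ⟩
  mkℚᵘ (+ 1) n ℚᵘ.+ mkℚᵘ (+ m) n
    ≈⟨ ℚᵘₚ.+-cong (ℚₚ.toℚᵘ-fromℚᵘ (mkℚᵘ (+ 1) n)) (ℚₚ.toℚᵘ-fromℚᵘ (mkℚᵘ (+ m) n)) ⟨
  ℚ.toℚᵘ ((+ 1) ℚ./ suc n) ℚᵘ.+ ℚ.toℚᵘ ((+ m) ℚ./ suc n)
    ≈⟨ ℚₚ.toℚᵘ-homo-+ ((+ 1) ℚ./ suc n) ((+ m) ℚ./ suc n) ⟨
  ℚ.toℚᵘ ((+ 1) ℚ./ suc n ℚ.+ (+ m) ℚ./ suc n) ∎)
  where
  open import Relation.Binary.Reasoning.Setoid ℚᵘₚ.≃-setoid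
  numerators : (+ suc m) ℤ.* (+ (suc n ℕ.* suc n)) ≡ ((+ 1) ℤ.* (+ suc n) ℤ.+ (+ m) ℤ.* (+ suc n)) ℤ.* (+ suc n)
  numerators = ≡.trans (≡.cong ((+ suc m) ℤ.*_) (ℤₚ.pos-* (suc n) (suc n)))
    (≡.trans (≡.sym (ℤₚ.*-assoc (+ suc m) (+ suc n) (+ suc n)))
      (≡.cong (ℤ._* (+ suc n)) (ℤₚ.*-distribʳ-+ (+ suc n) (+ 1) (+ m))))

module Range {c ℓ : Level} (M : Monoid c ℓ) where

  open Monoid M
  open import Algebra.Properties.Monoid.Sum M using (sum)

  -- `sum` recurses at the front, while inductions on the length split off the last term. A general
  -- monoid covers sums and products at once.
  sum-last : ∀ n (f : ℕ → Carrier) →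
    sum {suc n} (f ∘ toℕ) ≈ sum {n} (f ∘ toℕ) ∙ f n
  sum-last zero    f = trans (identityʳ _) (sym (identityˡ _))
  sum-last (suc n) f = trans (∙-congˡ (sum-last n (f ∘ suc))) (sym (assoc _ _ _))

parity : ∀ n → ∃ λ k → n ≡ 2 ℕ.* k ⊎ n ≡ suc (2 ℕ.* k)
parity zero    = 0 , inj₁ ≡.refl
parity (suc n) with parity n
... | k , inj₁ eq = k , inj₂ (≡.cong suc eq)
... | k , inj₂ eq = suc k , inj₁ (≡.trans (≡.cong suc eq) (≡.sym (ℕₚ.*-suc 2 k)))

-- Factorials and Pochhammer symbols in a ℚ-algebra.

module Coefficients {c ℓ : Level} (A : ℚ-Algebra c ℓ) where

  open ℚ-Algebra A hiding (zero)
  open Over A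
  open RingMorphisms.IsRingHomomorphism ι-isRingHomomorphism
    using () renaming (+-homo to ι-+; 0#-homo to ι-0; 1#-homo to ι-1)
  open import Algebra.Properties.Monoid.Mult +-monoid using (×-homo-+)
  open import Algebra.Properties.Semiring.Mult semiring using (×1-homo-*; ×-assoc-*; ×-congʳ)
  open import Algebra.Properties.Ring ring
    using (-1*x≈-x; -‿distribˡ-*; -‿distribʳ-*; ⁻¹-anti-homo‿-; -0#≈0#; xyx⁻¹≈y)
  open import Algebra.Properties.Semiring.Sum semiring
    using (sum-cong-≋; sum-replicate-zero; ∑-distrib-+; *-distribˡ-sum)
  open import Algebra.Solver.Ring.NaturalCoefficients.Default commutativeSemiring
    using (solve; _:=_; _:*_; _:+_)
  open import Relation.Binary.Reasoning.Setoid setoid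
  open Range +-monoid using (sum-last)
  open Range *-monoid using () renaming (sum-last to product-last)

  fromℕ-+ : ∀ m n → fromℕ (m ℕ.+ n) ≈ fromℕ m + fromℕ n
  fromℕ-+ = ×-homo-+ 1#

  fromℕ-* : ∀ m n → fromℕ (m ℕ.* n) ≈ fromℕ m * fromℕ n
  fromℕ-* = ×1-homo-*

  ·-fromℕ : ∀ n x → n · x ≈ fromℕ n * x
  ·-fromℕ n x = sym (trans (×-assoc-* n 1# x) (×-congʳ n (*-identityˡ x)))

  -- The numerator is taken apart one unit at a time, so that additivity of `ι` suffices. All
  -- fractions are thereby reduced to multiples of `1 /! k`.
  /!-fromℕ : ∀ m k → m /! k ≈ fromℕ m * (1 /! k)
  /!-fromℕ zero    k = begin
    0 /! k              ≡⟨ ≡.cong ι (ℚₚ.0/n≡0 (k !)) ⟩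
    ι ℚ.0ℚ              ≈⟨ ι-0 ⟩
    0#                  ≈⟨ zeroˡ _ ⟨
    0# * (1 /! k)       ∎
    where instance _ = k ℕₚ.!≢0
  /!-fromℕ (suc m) k = begin
    suc m /! k                        ≡⟨ ≡.cong ι (/-suc m (k !)) ⟩
    _                                 ≈⟨ ι-+ _ _ ⟩
    (1 /! k) + (m /! k)               ≈⟨ +-cong (sym (*-identityˡ _)) (/!-fromℕ m k) ⟩
    1# * (1 /! k) + fromℕ m * (1 /! k) ≈⟨ distribʳ _ _ _ ⟨
    fromℕ (suc m) * (1 /! k)          ∎
    where instance _ = k ℕₚ.!≢0

  1/!-suc : ∀ k → fromℕ (suc k) * (1 /! suc k) ≈ 1 /! k
  1/!-suc k = trans (sym (/!-fromℕ (suc k) (suc k)))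
    (reflexive (≡.cong ι (/-≡ {suc k} {suc k !} {1} {k !} (≡.sym (ℕₚ.*-identityˡ _)))))
    where instance
      _ = k ℕₚ.!≢0
      _ = suc k ℕₚ.!≢0

  !*1/! : ∀ k → fromℕ (k !) * (1 /! k) ≈ 1#
  !*1/! k = trans (sym (/!-fromℕ (k !) k))
    (trans (reflexive (≡.cong ι (/-≡ {k !} {k !} {1} {1} (ℕₚ.*-comm (k !) 1)))) ι-1)
    where instance _ = k ℕₚ.!≢0

  1/!0 : 1 /! 0 ≈ 1#
  1/!0 = ι-1

  2*½ : ∀ s → fromℕ 2 * (ι ½ * s) ≈ s
  -- `2 !` is 2 and `1 /! 2` computes to `ι ½`.
  2*½ s = trans (sym (*-assoc _ _ _)) (trans (*-congʳ (!*1/! 2)) (*-identityˡ s))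

  2*[s/2+n] : ∀ s n → fromℕ 2 * (ι ½ * s + fromℕ n) ≈ s + fromℕ (2 ℕ.* n)
  2*[s/2+n] s n = trans (distribˡ _ _ _) (+-cong (2*½ s) (sym (fromℕ-* 2 n)))

  pochhammer-suc : ∀ γ i → pochhammer γ (suc i) ≈ pochhammer γ i * (γ + fromℕ i)
  pochhammer-suc γ i = product-last i (λ j → γ + fromℕ j)

  -- Positive integers are units in a ℚ-algebra: `fromℕ (n !) * (1 /! suc n)` is inverse to
  -- `fromℕ (suc n)`.
  fromℕ-suc-cancel : ∀ n {x} → fromℕ (suc n) * x ≈ 0# → x ≈ 0#
  fromℕ-suc-cancel n {x} eq = begin
    x                                             ≈⟨ *-identityˡ x ⟨
    1# * x                                        ≈⟨ *-congʳ (!*1/! n) ⟨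
    fromℕ (n !) * (1 /! n) * x                    ≈⟨ *-congʳ (*-congˡ (1/!-suc n)) ⟨
    fromℕ (n !) * (fromℕ (suc n) * (1 /! suc n)) * x
      ≈⟨ solve 4 (λ a b c x → a :* (b :* c) :* x := a :* c :* (b :* x)) refl
           (fromℕ (n !)) (fromℕ (suc n)) (1 /! suc n) x ⟩
    fromℕ (n !) * (1 /! suc n) * (fromℕ (suc n) * x)  ≈⟨ *-congˡ eq ⟩
    fromℕ (n !) * (1 /! suc n) * 0#               ≈⟨ zeroʳ _ ⟩
    0#                                            ∎

  -- Products and quotients of power series.

  ⊛-cong : ∀ {f f′ g g′ : PowerSeries} → (∀ n → f n ≈ f′ n) → (∀ n → g n ≈ g′ n) →
    ∀ n → (f ⊛ g) n ≈ (f′ ⊛ g′) n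
  ⊛-cong f≈ g≈ n = sum-cong-≋ {suc n} λ k → *-cong (f≈ (toℕ k)) (g≈ (n ∸ toℕ k))

  -- As `g 0` is 1, the leading coefficients of `f` and `q` agree. Removing the leading coefficient
  -- times `g` and shifting leaves the same problem for the tail `q ∘ suc`, which is exactly the
  -- recursion of long division.
  ⊘-unique : ∀ (f g q : PowerSeries) → g 0 ≈ 1# → (∀ n → (q ⊛ g) n ≈ f n) →
    ∀ n → (f ⊘ g) n ≈ q n
  ⊘-unique f g q g₀ qg≈f = go
    where
    f₀ : f 0 ≈ q 0
    f₀ = trans (sym (qg≈f 0)) (trans (+-identityʳ _) (trans (*-congˡ g₀) (*-identityʳ _)))

    go : ∀ n → (f ⊘ g) n ≈ q n
    go zero    = f₀
    go (suc n) = ⊘-unique _ g (q ∘ suc) g₀ tail n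
      where
      tail : ∀ k → ((q ∘ suc) ⊛ g) k ≈ f (suc k) - f 0 * g (suc k)
      tail k = begin
        ((q ∘ suc) ⊛ g) k
          ≈⟨ xyx⁻¹≈y _ _ ⟨
        q 0 * g (suc k) + ((q ∘ suc) ⊛ g) k - q 0 * g (suc k)
          ≈⟨ +-cong (qg≈f (suc k)) (-‿cong (*-congʳ (sym f₀))) ⟩
        f (suc k) - f 0 * g (suc k) ∎

  -- The operator x d/dx, which unlike d/dx does not shift the index.
  euler : PowerSeries → PowerSeries
  euler f n = fromℕ n * f n

  -- The Leibniz rule: in each term `f i * g j` the weight `n = i + j` splits into its two summands.
  euler-⊛ : ∀ f g n → euler (f ⊛ g) n ≈ (euler f ⊛ g) n + (f ⊛ euler g) n
  euler-⊛ f g n = begin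
    fromℕ n * sum {suc n} (λ k → f (toℕ k) * g (n ∸ toℕ k))
      ≈⟨ *-distribˡ-sum {suc n} (fromℕ n) (λ k → f (toℕ k) * g (n ∸ toℕ k)) ⟩
    sum {suc n} (λ k → fromℕ n * (f (toℕ k) * g (n ∸ toℕ k)))
      ≈⟨ sum-cong-≋ {suc n} split ⟩
    sum {suc n} (λ k → euler f (toℕ k) * g (n ∸ toℕ k) + f (toℕ k) * euler g (n ∸ toℕ k))
      ≈⟨ ∑-distrib-+ {suc n} (λ k → euler f (toℕ k) * g (n ∸ toℕ k))
           (λ k → f (toℕ k) * euler g (n ∸ toℕ k)) ⟩
    (euler f ⊛ g) n + (f ⊛ euler g) n ∎
    where
    split : ∀ (k : Fin (suc n)) → fromℕ n * (f (toℕ k) * g (n ∸ toℕ k))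
      ≈ euler f (toℕ k) * g (n ∸ toℕ k) + f (toℕ k) * euler g (n ∸ toℕ k)
    split k = begin
      fromℕ n * (f i * g j)
        ≡⟨ ≡.cong (λ m → fromℕ m * (f i * g j)) (ℕₚ.m+[n∸m]≡n (ℕ.s≤s⁻¹ (toℕ<n k))) ⟨
      fromℕ (i ℕ.+ j) * (f i * g j)
        ≈⟨ *-congʳ (fromℕ-+ i j) ⟩
      (fromℕ i + fromℕ j) * (f i * g j)
        ≈⟨ solve 4 (λ m n a b → (m :+ n) :* (a :* b) := m :* a :* b :+ a :* (n :* b)) refl
             (fromℕ i) (fromℕ j) (f i) (g j) ⟩
      euler f i * g j + f i * euler g j ∎
      where
      i = toℕ k
      j = n ∸ toℕ k

  -- The two recurrences say (1 - y) e′ = t e and (1 - y) d′ = - t d, so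
  -- e d is constant.
  module _ (t : Carrier) (e d : PowerSeries)
    (e-suc : ∀ i → fromℕ (suc i) * e (suc i) ≈ (t + fromℕ i) * e i)
    (d-suc : ∀ j → fromℕ (suc j) * d (suc j) ≈ (fromℕ j - t) * d j)
    where

    -- After the recurrences are applied, the terms with `i + j = n` combine with weight
    -- `(t + i) + (j - t) = n`.
    euler-⊛-suc : ∀ n → euler (e ⊛ d) (suc n) ≈ euler (e ⊛ d) n
    euler-⊛-suc n = begin
      euler (e ⊛ d) (suc n)
        ≈⟨ euler-⊛ e d (suc n) ⟩
      euler e 0 * d (suc n) + sum {suc n} (λ k → euler e (suc (toℕ k)) * d (n ∸ toℕ k))
        + (e ⊛ euler d) (suc n)
        -- The first term of one sum and the last of the other have weight 0; without them both sums
        -- run over `i + j = n`.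
        ≈⟨ +-cong
             (trans (+-congʳ (trans (*-congʳ (zeroˡ _)) (zeroˡ _))) (+-identityˡ _))
             (trans (sum-last (suc n) (λ k → e k * euler d (suc n ∸ k)))
               (trans (+-congˡ last≈0) (+-identityʳ _))) ⟩
      sum {suc n} (λ k → euler e (suc (toℕ k)) * d (n ∸ toℕ k))
        + sum {suc n} (λ k → e (toℕ k) * euler d (suc n ∸ toℕ k))
        ≈⟨ ∑-distrib-+ {suc n} (λ k → euler e (suc (toℕ k)) * d (n ∸ toℕ k))
             (λ k → e (toℕ k) * euler d (suc n ∸ toℕ k)) ⟨
      sum {suc n} (λ k → euler e (suc (toℕ k)) * d (n ∸ toℕ k)
        + e (toℕ k) * euler d (suc n ∸ toℕ k))
        ≈⟨ sum-cong-≋ {suc n} term ⟩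
      sum {suc n} (λ k → fromℕ n * (e (toℕ k) * d (n ∸ toℕ k)))
        ≈⟨ *-distribˡ-sum {suc n} (fromℕ n) (λ k → e (toℕ k) * d (n ∸ toℕ k)) ⟨
      euler (e ⊛ d) n ∎
      where
      last≈0 : e (suc n) * euler d (n ∸ n) ≈ 0#
      last≈0 = trans (*-congˡ (trans (reflexive (≡.cong (euler d) (ℕₚ.n∸n≡0 n))) (zeroˡ _))) (zeroʳ _)

      term : ∀ (k : Fin (suc n)) →
        euler e (suc (toℕ k)) * d (n ∸ toℕ k) + e (toℕ k) * euler d (suc n ∸ toℕ k)
          ≈ fromℕ n * (e (toℕ k) * d (n ∸ toℕ k))
      term k = begin
        euler e (suc i) * d j + e i * euler d (suc n ∸ i)
          ≡⟨ ≡.cong (λ l → euler e (suc i) * d j + e i * euler d l) (ℕₚ.+-∸-assoc 1 i≤n) ⟩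
        euler e (suc i) * d j + e i * euler d (suc j)
          ≈⟨ +-cong (*-congʳ (e-suc i)) (*-congˡ (d-suc j)) ⟩
        (t + fromℕ i) * e i * d j + e i * ((fromℕ j - t) * d j)
          ≈⟨ solve 6 (λ t i e d j t′ → (t :+ i) :* e :* d :+ e :* ((j :+ t′) :* d)
                        := (t :+ t′ :+ (i :+ j)) :* (e :* d)) refl
               t (fromℕ i) (e i) (d j) (fromℕ j) (- t) ⟩
        (t - t + (fromℕ i + fromℕ j)) * (e i * d j)
          ≈⟨ *-congʳ (trans (+-congʳ (-‿inverseʳ t)) (+-identityˡ _)) ⟩
        (fromℕ i + fromℕ j) * (e i * d j)
          ≈⟨ *-congʳ (fromℕ-+ i j) ⟨
        fromℕ (i ℕ.+ j) * (e i * d j)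
          ≡⟨ ≡.cong (λ m → fromℕ m * (e i * d j)) (ℕₚ.m+[n∸m]≡n i≤n) ⟩
        fromℕ n * (e i * d j) ∎
        where
        i = toℕ k
        j = n ∸ toℕ k
        i≤n : i ℕ.≤ n
        i≤n = ℕ.s≤s⁻¹ (toℕ<n k)

    euler-⊛≈0 : ∀ n → euler (e ⊛ d) n ≈ 0#
    euler-⊛≈0 zero    = zeroˡ _
    euler-⊛≈0 (suc n) = trans (euler-⊛-suc n) (euler-⊛≈0 n)

    -- `euler (e ⊛ d)` is constant in the index and starts at 0, so `n + 1` annihilates coefficient
    -- `n + 1` and can be cancelled.
    ⊛-inverse : e 0 ≈ 1# → d 0 ≈ 1# → ∀ n → (e ⊛ d) n ≈ 𝟙 n
    ⊛-inverse e₀ d₀ zero    = trans (+-identityʳ _) (trans (*-cong e₀ d₀) (*-identityˡ _))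
    ⊛-inverse e₀ d₀ (suc n) = fromℕ-suc-cancel n (euler-⊛≈0 (suc n))

  -- Substitution of x² and -x² into power series.

  -- f(x) ↦ f(x²)
  spread : PowerSeries → PowerSeries
  spread f zero          = f 0
  spread f (suc zero)    = 0#
  spread f (suc (suc n)) = spread (f ∘ suc) n

  -- f(x) ↦ (1 + x) f(x²)
  double : PowerSeries → PowerSeries
  double f zero          = f 0
  double f (suc zero)    = f 0
  double f (suc (suc n)) = double (f ∘ suc) n

  double-cong : ∀ {f g : PowerSeries} → (∀ n → f n ≈ g n) → ∀ n → double f n ≈ double g n
  double-cong f≈g zero          = f≈g 0
  double-cong f≈g (suc zero)    = f≈g 0
  double-cong f≈g (suc (suc n)) = double-cong (f≈g ∘ suc) n

  double-even : ∀ f k → double f (2 ℕ.* k) ≡ f k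
  double-even f zero    = ≡.refl
  double-even f (suc k) = ≡.trans (≡.cong (double f) (ℕₚ.*-suc 2 k)) (double-even (f ∘ suc) k)

  double-odd : ∀ f k → double f (suc (2 ℕ.* k)) ≡ f k
  double-odd f zero    = ≡.refl
  double-odd f (suc k) = ≡.trans (≡.cong (double f ∘ suc) (ℕₚ.*-suc 2 k)) (double-odd (f ∘ suc) k)

  double-linear : ∀ x f g n →
    x * double f n + double g n ≈ double (λ k → x * f k + g k) n
  double-linear x f g zero          = refl
  double-linear x f g (suc zero)    = refl
  double-linear x f g (suc (suc n)) = double-linear x (f ∘ suc) (g ∘ suc) n

  -- The identity between `double f` and (1 + x) f(x²), read off at degree `n + 2`.
  spread-pair : ∀ f n → spread f (suc (suc n)) + spread f (suc n) ≈ double (f ∘ suc) n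
  spread-pair f zero          = +-identityʳ _
  spread-pair f (suc zero)    = +-identityˡ _
  spread-pair f (suc (suc n)) = spread-pair (f ∘ suc) n

  -- Substituting x² respects products, and the factor 1 + x is carried along. The induction removes
  -- two degrees at once: the first two coefficients of `double f` are both `f 0`, and the rest is
  -- `double (f ∘ suc)`.
  double-⊛-spread : ∀ f g n → (double f ⊛ spread g) n ≈ double (f ⊛ g) n
  double-⊛-spread f g zero       = refl
  double-⊛-spread f g (suc zero) = trans (+-congʳ (zeroʳ _)) (+-identityˡ _)
  double-⊛-spread f g (suc (suc n)) = begin
    f 0 * spread g (suc (suc n)) + (f 0 * spread g (suc n) + (double (f ∘ suc) ⊛ spread g) n)
      ≈⟨ solve 4 (λ x a b h → x :* a :+ (x :* b :+ h) := x :* (a :+ b) :+ h) refl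
           (f 0) (spread g (suc (suc n))) (spread g (suc n)) _ ⟩
    f 0 * (spread g (suc (suc n)) + spread g (suc n)) + (double (f ∘ suc) ⊛ spread g) n
      ≈⟨ +-cong (*-congˡ (spread-pair g n)) (double-⊛-spread (f ∘ suc) g n) ⟩
    f 0 * double (g ∘ suc) n + double ((f ∘ suc) ⊛ g) n
      ≈⟨ double-linear (f 0) (g ∘ suc) ((f ∘ suc) ⊛ g) n ⟩
    double (λ k → (f ⊛ g) (suc k)) n ∎

  X-⊛-zero : ∀ f → (X ⊛ f) 0 ≈ 0#
  X-⊛-zero f = trans (+-identityʳ _) (zeroˡ _)

  X-⊛-suc : ∀ f n → (X ⊛ f) (suc n) ≈ f n
  X-⊛-suc f n = begin
    0# * f (suc n) + (1# * f n + sum {n} (λ k → 0# * f (n ∸ suc (toℕ k))))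
      ≈⟨ +-cong (zeroˡ _) (+-cong (*-identityˡ _)
           (trans (sum-cong-≋ {n} (λ k → zeroˡ _)) (sum-replicate-zero n))) ⟩
    0# + (f n + 0#)
      ≈⟨ trans (+-identityˡ _) (+-identityʳ _) ⟩
    f n ∎

  *-zeroˡ-cong : ∀ {x y} → x ≈ 0# → x * y ≈ 0#
  *-zeroˡ-cong x≈0 = trans (*-congʳ x≈0) (zeroˡ _)

  -x² : PowerSeries
  -x² = ⊖ (X ⊛ X)

  -x²-0 : -x² 0 ≈ 0#
  -x²-0 = trans (-‿cong (X-⊛-zero X)) -0#≈0#

  -x²-1 : -x² 1 ≈ 0#
  -x²-1 = trans (-‿cong (X-⊛-suc X 0)) -0#≈0#

  -x²-⊛-0 : ∀ f → (-x² ⊛ f) 0 ≈ 0#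
  -x²-⊛-0 f = trans (+-identityʳ _) (*-zeroˡ-cong -x²-0)

  -x²-⊛-1 : ∀ f → (-x² ⊛ f) 1 ≈ 0#
  -x²-⊛-1 f = trans
    (+-cong (*-zeroˡ-cong -x²-0) (trans (+-identityʳ _) (*-zeroˡ-cong -x²-1)))
    (+-identityˡ _)

  -x²-⊛-suc² : ∀ f n → (-x² ⊛ f) (suc (suc n)) ≈ - f n
  -x²-⊛-suc² f n = begin
    -x² 0 * f (suc (suc n)) + (-x² 1 * f (suc n) + sum {suc n} (λ k → -x² (2 ℕ.+ toℕ k) * f (n ∸ toℕ k)))
      ≈⟨ +-cong (*-zeroˡ-cong -x²-0) (trans (+-congʳ (*-zeroˡ-cong -x²-1)) (+-identityˡ _)) ⟩
    0# + (-x² 2 * f n + sum {n} (λ k → -x² (3 ℕ.+ toℕ k) * f (n ∸ suc (toℕ k))))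
      ≈⟨ +-identityˡ _ ⟩
    -x² 2 * f n + sum {n} (λ k → -x² (3 ℕ.+ toℕ k) * f (n ∸ suc (toℕ k)))
      ≈⟨ +-cong (*-congʳ (-‿cong (X-⊛-suc X 1)))
           (trans (sum-cong-≋ {n} (λ k → *-zeroˡ-cong (-x²-3+ (toℕ k)))) (sum-replicate-zero n)) ⟩
    - 1# * f n + 0#
      ≈⟨ trans (+-identityʳ _) (-1*x≈-x _) ⟩
    - f n ∎
    where
    -x²-3+ : ∀ m → -x² (3 ℕ.+ m) ≈ 0#
    -x²-3+ m = trans (-‿cong (X-⊛-suc X (2 ℕ.+ m))) -0#≈0#

  -- f(y) ↦ f(-y).
  alternate : PowerSeries → PowerSeries
  alternate f k = ((- 1#) ^ k) * f k

  spread-cong : ∀ {f g : PowerSeries} → (∀ n → f n ≈ g n) → ∀ n → spread f n ≈ spread g n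
  spread-cong f≈g zero          = f≈g 0
  spread-cong f≈g (suc zero)    = refl
  spread-cong f≈g (suc (suc n)) = spread-cong (f≈g ∘ suc) n

  -- Each power beyond the zeroth contains a factor -x², which shifts by two degrees and changes the
  -- sign. The bound `N` is independent of `n` because the induction lowers `N` by one but `n` by
  -- two; `β` is arbitrary because it is replaced by its negated shift.
  compose--x² : ∀ β N n → n ℕ.< N →
    sum {N} (λ k → β (toℕ k) * (-x² ⊛^ toℕ k) n) ≈ spread (alternate β) n
  compose--x² β (suc N) n n<N = trans (+-congˡ (tail n n<N)) (head n)
    where
    rest : PowerSeries
    rest zero          = 0#
    rest (suc zero)    = 0#
    rest (suc (suc n)) = spread (alternate β ∘ suc) n

    vanishing : ∀ {n} → (∀ f → (-x² ⊛ f) n ≈ 0#) →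
      sum {N} (λ k → β (suc (toℕ k)) * (-x² ⊛^ suc (toℕ k)) n) ≈ 0#
    vanishing eq = trans
      (sum-cong-≋ {N} (λ k → trans (*-congˡ (eq (-x² ⊛^ toℕ k))) (zeroʳ _)))
      (sum-replicate-zero N)

    tail : ∀ n → n ℕ.< suc N →
      sum {N} (λ k → β (suc (toℕ k)) * (-x² ⊛^ suc (toℕ k)) n) ≈ rest n
    tail zero          _   = vanishing -x²-⊛-0
    tail (suc zero)    _   = vanishing -x²-⊛-1
    tail (suc (suc n)) n<N = begin
      sum {N} (λ k → β (suc (toℕ k)) * (-x² ⊛^ suc (toℕ k)) (suc (suc n)))
        ≈⟨ sum-cong-≋ {N} (λ k → trans (*-congˡ (-x²-⊛-suc² (-x² ⊛^ toℕ k) n))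
             (trans (sym (-‿distribʳ-* _ _)) (-‿distribˡ-* _ _))) ⟩
      sum {N} (λ k → - β (suc (toℕ k)) * (-x² ⊛^ toℕ k) n)
        ≈⟨ compose--x² (λ k → - β (suc k)) N n (ℕₚ.≤-trans (ℕₚ.n≤1+n _) (ℕ.s≤s⁻¹ n<N)) ⟩
      spread (alternate (λ k → - β (suc k))) n
        -- The minus sign of -x² becomes the additional factor in `(- 1#) ^ suc k`.
        ≈⟨ spread-cong (λ k → trans (sym (-‿distribʳ-* _ _))
             (trans (-‿distribˡ-* _ _) (*-congʳ (sym (-1*x≈-x _))))) n ⟩
      spread (alternate β ∘ suc) n ∎

    head : ∀ n → β 0 * 𝟙 n + rest n ≈ spread (alternate β) n
    head zero          = trans (+-identityʳ _) (*-comm _ _)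
    head (suc zero)    = trans (+-identityʳ _) (zeroʳ _)
    head (suc (suc n)) = trans (+-congʳ (zeroʳ _)) (+-identityˡ _)

  -- The coefficients of f and their successive ratios.

  module _ (s : Carrier) where

    private
      t = ι ½ * s

    -- The coefficients of (1 - y)^(-t) and (1 - y)^t.
    e d : PowerSeries
    e i = (1 /! i) * pochhammer t i
    d   = alternate (binomial t)

    e-suc : ∀ i → fromℕ (suc i) * e (suc i) ≈ (t + fromℕ i) * e i
    e-suc i = begin
      fromℕ (suc i) * ((1 /! suc i) * pochhammer t (suc i))
        ≈⟨ *-assoc _ _ _ ⟨
      fromℕ (suc i) * (1 /! suc i) * pochhammer t (suc i)
        ≈⟨ *-cong (1/!-suc i) (pochhammer-suc t i) ⟩
      (1 /! i) * (pochhammer t i * (t + fromℕ i))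
        ≈⟨ trans (sym (*-assoc _ _ _)) (*-comm _ _) ⟩
      (t + fromℕ i) * e i ∎

    -- The binomial coefficient gains the factor `(t - j) / (j + 1)`, and the additional sign turns
    -- `t - j` into `j - t`.
    d-suc : ∀ j → fromℕ (suc j) * d (suc j) ≈ (fromℕ j - t) * d j
    d-suc j = begin
      fromℕ (suc j) * (- 1# * ε * ((1 /! suc j) * product {suc j} (λ i → t - fromℕ (toℕ i))))
        ≈⟨ *-congˡ (*-congˡ (*-congˡ (product-last j (λ i → t - fromℕ i)))) ⟩
      fromℕ (suc j) * (- 1# * ε * ((1 /! suc j) * (p * (t - fromℕ j))))
        ≈⟨ solve 6 (λ n m ε q p x → n :* (m :* ε :* (q :* (p :* x)))
                      := m :* x :* (ε :* (n :* q :* p))) refl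
             (fromℕ (suc j)) (- 1#) ε (1 /! suc j) p (t - fromℕ j) ⟩
      - 1# * (t - fromℕ j) * (ε * (fromℕ (suc j) * (1 /! suc j) * p))
        ≈⟨ *-cong (trans (-1*x≈-x _) (⁻¹-anti-homo‿- _ _)) (*-congˡ (*-congʳ (1/!-suc j))) ⟩
      (fromℕ j - t) * d j ∎
      where
      ε = (- 1#) ^ j
      p = product {j} (λ i → t - fromℕ (toℕ i))

    e-0 : e 0 ≈ 1#
    e-0 = trans (*-identityʳ _) 1/!0

    d-0 : d 0 ≈ 1#
    d-0 = trans (*-identityˡ _) (trans (*-identityʳ _) 1/!0)

    -- By uniqueness of the quotient it suffices that (1 + x) e(x²) d(x²) = 1 + x, which is
    -- `e ⊛ d = 𝟙` after substituting x².
    fₛ-coeff : ∀ n → fₛ s n ≈ double e n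
    fₛ-coeff = ⊘-unique (𝟙 ⊕ X) ([1+ -x² ]^ t) (double e)
      (trans (denominator 0) d-0)
      (λ n → begin
        (double e ⊛ [1+ -x² ]^ t) n  ≈⟨ ⊛-cong {double e} (λ _ → refl) denominator n ⟩
        (double e ⊛ spread d) n      ≈⟨ double-⊛-spread e d n ⟩
        double (e ⊛ d) n             ≈⟨ double-cong (⊛-inverse t e d e-suc d-suc e-0 d-0) n ⟩
        double 𝟙 n                   ≈⟨ 1+x n ⟩
        (𝟙 ⊕ X) n                    ∎)
      where
      denominator : ∀ n → ([1+ -x² ]^ t) n ≈ spread d n
      denominator n = compose--x² (binomial t) (suc n) n (ℕₚ.n<1+n n)

      double-0 : ∀ n → double (λ _ → 0#) n ≡ 0#
      double-0 zero          = ≡.refl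
      double-0 (suc zero)    = ≡.refl
      double-0 (suc (suc n)) = double-0 n

      1+x : ∀ n → double 𝟙 n ≈ (𝟙 ⊕ X) n
      1+x zero          = sym (+-identityʳ _)
      1+x (suc zero)    = sym (+-identityˡ _)
      1+x (suc (suc n)) = trans (reflexive (double-0 n)) (sym (+-identityˡ _))

    a : ℕ → Carrier
    a = egfCoeff (fₛ s)

    a-double : ∀ n → a n ≈ fromℕ (n !) * double e n
    a-double n = trans (·-fromℕ (n !) _) (*-congˡ (fₛ-coeff n))

    a-even : ∀ k → a (2 ℕ.* k) ≈ ((2 ℕ.* k) ! /! k) * pochhammer t k
    a-even k = begin
      a (2 ℕ.* k)                                          ≈⟨ a-double (2 ℕ.* k) ⟩
      fromℕ ((2 ℕ.* k) !) * double e (2 ℕ.* k)             ≡⟨ ≡.cong (fromℕ ((2 ℕ.* k) !) *_) (double-even e k) ⟩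
      fromℕ ((2 ℕ.* k) !) * ((1 /! k) * pochhammer t k)    ≈⟨ *-assoc _ _ _ ⟨
      fromℕ ((2 ℕ.* k) !) * (1 /! k) * pochhammer t k      ≈⟨ *-congʳ (/!-fromℕ ((2 ℕ.* k) !) k) ⟨
      ((2 ℕ.* k) ! /! k) * pochhammer t k                  ∎

    -- The factor leading from `a n` to `a (suc n)`. Recursion in steps of two makes `ratio-+` a
    -- plain induction on `i`.
    ratio : ℕ → Carrier
    ratio zero          = 1#
    ratio (suc zero)    = s
    ratio (suc (suc n)) = fromℕ 2 + ratio n

    -- The source of the Vandermonde shape: the row index enters the ratio only as an added `2i`,
    -- the variable of polynomials whose shifts depend on the column alone.
    ratio-+ : ∀ i j → ratio (2 ℕ.* i ℕ.+ j) ≈ fromℕ (2 ℕ.* i) + ratio j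
    ratio-+ zero    j = sym (+-identityˡ _)
    ratio-+ (suc i) j = begin
      ratio (2 ℕ.* suc i ℕ.+ j)               ≡⟨ ≡.cong (λ m → ratio (m ℕ.+ j)) (ℕₚ.*-suc 2 i) ⟩
      fromℕ 2 + ratio (2 ℕ.* i ℕ.+ j)         ≈⟨ +-congˡ (ratio-+ i j) ⟩
      fromℕ 2 + (fromℕ (2 ℕ.* i) + ratio j)   ≈⟨ +-assoc _ _ _ ⟨
      fromℕ 2 + fromℕ (2 ℕ.* i) + ratio j     ≈⟨ +-congʳ (fromℕ-+ 2 (2 ℕ.* i)) ⟨
      fromℕ (2 ℕ.+ 2 ℕ.* i) + ratio j         ≡⟨ ≡.cong (λ m → fromℕ m + ratio j) (ℕₚ.*-suc 2 i) ⟨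
      fromℕ (2 ℕ.* suc i) + ratio j           ∎

    ratio-even : ∀ k → ratio (2 ℕ.* k) ≈ fromℕ (suc (2 ℕ.* k))
    ratio-even k = begin
      ratio (2 ℕ.* k)           ≡⟨ ≡.cong ratio (ℕₚ.+-identityʳ (2 ℕ.* k)) ⟨
      ratio (2 ℕ.* k ℕ.+ 0)     ≈⟨ ratio-+ k 0 ⟩
      fromℕ (2 ℕ.* k) + 1#      ≈⟨ +-comm _ _ ⟩
      fromℕ (suc (2 ℕ.* k))     ∎

    -- From an even index the two coefficients coincide and the ratio is the factor `2k + 1` itself.
    -- From an odd index, twice `e-suc` gives the ratio `2 (t + k) = s + 2k`.
    double-e-suc : ∀ n → fromℕ (suc n) * double e (suc n) ≈ ratio n * double e n
    double-e-suc n with parity n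
    ... | k , inj₁ ≡.refl = *-cong (sym (ratio-even k))
      (reflexive (≡.trans (double-odd e k) (≡.sym (double-even e k))))
    ... | k , inj₂ ≡.refl = begin
      fromℕ (2 ℕ.+ 2 ℕ.* k) * double e (2 ℕ.+ 2 ℕ.* k)
        ≡⟨ ≡.cong₂ (λ m x → fromℕ m * x) (≡.sym (ℕₚ.*-suc 2 k)) (double-even (e ∘ suc) k) ⟩
      fromℕ (2 ℕ.* suc k) * e (suc k)
        ≈⟨ trans (*-congʳ (fromℕ-* 2 (suc k))) (*-assoc _ _ _) ⟩
      fromℕ 2 * (fromℕ (suc k) * e (suc k))
        ≈⟨ trans (*-congˡ (e-suc k)) (sym (*-assoc _ _ _)) ⟩
      fromℕ 2 * (t + fromℕ k) * e k
        ≈⟨ *-congʳ (trans (2*[s/2+n] s k) (+-comm _ _)) ⟩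
      (fromℕ (2 ℕ.* k) + s) * e k
        ≈⟨ *-congʳ (ratio-+ k 1) ⟨
      ratio (2 ℕ.* k ℕ.+ 1) * e k
        ≡⟨ ≡.cong₂ (λ m x → ratio m * x) (≡.sym (ℕₚ.+-comm 1 (2 ℕ.* k))) (≡.sym (double-odd e k)) ⟩
      ratio (suc (2 ℕ.* k)) * double e (suc (2 ℕ.* k)) ∎

    a-suc : ∀ n → a (suc n) ≈ ratio n * a n
    a-suc n = begin
      a (suc n)                                          ≈⟨ a-double (suc n) ⟩
      fromℕ (suc n ℕ.* n !) * double e (suc n)           ≈⟨ *-congʳ (trans (fromℕ-* (suc n) (n !)) (*-comm _ _)) ⟩
      fromℕ (n !) * fromℕ (suc n) * double e (suc n)     ≈⟨ trans (*-assoc _ _ _) (*-congˡ (double-e-suc n)) ⟩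
      fromℕ (n !) * (ratio n * double e n)
        ≈⟨ solve 3 (λ x y z → x :* (y :* z) := y :* (x :* z)) refl (fromℕ (n !)) (ratio n) (double e n) ⟩
      ratio n * (fromℕ (n !) * double e n)               ≈⟨ *-congˡ (a-double n) ⟨
      ratio n * a n                                      ∎

    a-odd : ∀ k → a (2 ℕ.* k ℕ.+ 1) ≈ fromℕ (2 ℕ.* k ℕ.+ 1) * a (2 ℕ.* k)
    a-odd k = begin
      a (2 ℕ.* k ℕ.+ 1)                        ≡⟨ ≡.cong a (ℕₚ.+-comm (2 ℕ.* k) 1) ⟩
      a (suc (2 ℕ.* k))                        ≈⟨ a-suc (2 ℕ.* k) ⟩
      ratio (2 ℕ.* k) * a (2 ℕ.* k)            ≈⟨ *-congʳ (ratio-even k) ⟩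
      fromℕ (suc (2 ℕ.* k)) * a (2 ℕ.* k)      ≡⟨ ≡.cong (λ m → fromℕ m * a (2 ℕ.* k)) (ℕₚ.+-comm (2 ℕ.* k) 1) ⟨
      fromℕ (2 ℕ.* k ℕ.+ 1) * a (2 ℕ.* k)      ∎

-- The points 2i and the products that arise from them.

module Hankel {c ℓ : Level} (A : ℚ-Algebra c ℓ) where

  open ℚ-Algebra A hiding (zero)
  open Over A
  open Coefficients A
  open Determinant A
  open Vandermonde A
  open import Algebra.Properties.CommutativeMonoid.Sum *-commutativeMonoid
    using () renaming (sum-cong-≋ to product-cong; ∑-distrib-+ to product-distrib-*)
  open import Algebra.Properties.Semiring.Exp semiring using (^-homo-*; ^-congˡ; ^-congʳ)
  open import Algebra.Properties.AbelianGroup +-abelianGroup using (xyx⁻¹≈y)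
  open import Algebra.Solver.Ring.NaturalCoefficients.Default commutativeSemiring
    using (solve; _:=_; _:*_; _:+_)
  open import Relation.Binary.Reasoning.Setoid setoid
  open Range *-monoid using () renaming (sum-last to product-last)

  product-evens : ∀ n →
    product {n} (λ i → fromℕ (2 ℕ.* suc (toℕ i))) ≈ (fromℕ 2 ^ n) * fromℕ (n !)
  product-evens zero    = sym (trans (*-identityˡ _) (+-identityʳ _))
  product-evens (suc n) = begin
    product {suc n} (λ i → fromℕ (2 ℕ.* suc (toℕ i)))
      ≈⟨ product-last n (λ i → fromℕ (2 ℕ.* suc i)) ⟩
    product {n} (λ i → fromℕ (2 ℕ.* suc (toℕ i))) * fromℕ (2 ℕ.* suc n)
      ≈⟨ *-cong (product-evens n) (fromℕ-* 2 (suc n)) ⟩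
    (fromℕ 2 ^ n) * fromℕ (n !) * (fromℕ 2 * fromℕ (suc n))
      ≈⟨ solve 4 (λ p f t m → p :* f :* (t :* m) := t :* p :* (m :* f)) refl
           (fromℕ 2 ^ n) (fromℕ (n !)) (fromℕ 2) (fromℕ (suc n)) ⟩
    (fromℕ 2 ^ suc n) * (fromℕ (suc n) * fromℕ (n !))
      ≈⟨ *-congˡ (fromℕ-* (suc n) (n !)) ⟨
    (fromℕ 2 ^ suc n) * fromℕ (suc n !) ∎

  -- Each elimination step contributes the differences 2, 4, ..., 2n, whose product is `2^n n!`. The
  -- remaining points again progress by 2 but start at `y + 2`, hence the general offset `y`.
  det-newton-evens : ∀ r n (x : ℕ → Carrier) (y : Carrier) →
    (∀ i → x i ≈ y + fromℕ (2 ℕ.* i)) →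
    det {n} (λ i j → newton r (x (toℕ i)) (toℕ j))
      ≈ product {n} (λ k → (fromℕ 2 ^ toℕ k) * fromℕ (toℕ k !))
  det-newton-evens r zero    x y x≈ = refl
  det-newton-evens r (suc n) x y x≈ = begin
    det {suc n} (λ i j → newton r (x (toℕ i)) (toℕ j))
      ≈⟨ det-newton-suc r n x (λ i → fromℕ (2 ℕ.* i))
           (λ i → trans (x≈ i) (+-congʳ (sym (trans (x≈ 0) (+-identityʳ y))))) refl ⟩
    product {n} (λ i → fromℕ (2 ℕ.* suc (toℕ i)))
      * det {n} (λ i j → newton r (x (suc (toℕ i))) (toℕ j))
      ≈⟨ *-cong (product-evens n) (det-newton-evens r n (x ∘ suc) (y + fromℕ 2) x-suc) ⟩
    ((fromℕ 2 ^ n) * fromℕ (n !)) * product {n} (λ k → (fromℕ 2 ^ toℕ k) * fromℕ (toℕ k !))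
      ≈⟨ *-comm _ _ ⟩
    product {n} (λ k → (fromℕ 2 ^ toℕ k) * fromℕ (toℕ k !)) * ((fromℕ 2 ^ n) * fromℕ (n !))
      ≈⟨ product-last n (λ k → (fromℕ 2 ^ k) * fromℕ (k !)) ⟨
    product {suc n} (λ k → (fromℕ 2 ^ toℕ k) * fromℕ (toℕ k !)) ∎
    where
    x-suc : ∀ i → x (suc i) ≈ y + fromℕ 2 + fromℕ (2 ℕ.* i)
    x-suc i = begin
      x (suc i)                           ≈⟨ x≈ (suc i) ⟩
      y + fromℕ (2 ℕ.* suc i)             ≡⟨ ≡.cong (λ m → y + fromℕ m) (ℕₚ.*-suc 2 i) ⟩
      y + fromℕ (2 ℕ.+ 2 ℕ.* i)           ≈⟨ +-congˡ (fromℕ-+ 2 (2 ℕ.* i)) ⟩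
      y + (fromℕ 2 + fromℕ (2 ℕ.* i))     ≈⟨ +-assoc _ _ _ ⟨
      y + fromℕ 2 + fromℕ (2 ℕ.* i)       ∎

  product-powers-of-2 : ∀ m → ∏[1⋯ m ] (fromℕ 2 ^_) ≈ fromℕ 2 ^ (suc m C 2)
  product-powers-of-2 zero    = refl
  product-powers-of-2 (suc m) = begin
    ∏[1⋯ suc m ] (fromℕ 2 ^_)
      ≈⟨ product-last m (λ i → fromℕ 2 ^ suc i) ⟩
    ∏[1⋯ m ] (fromℕ 2 ^_) * (fromℕ 2 ^ suc m)
      ≈⟨ trans (*-comm _ _) (*-congˡ (product-powers-of-2 m)) ⟩
    (fromℕ 2 ^ suc m) * (fromℕ 2 ^ (suc m C 2))
      ≈⟨ ^-homo-* (fromℕ 2) (suc m) (suc m C 2) ⟨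
    fromℕ 2 ^ (suc m ℕ.+ suc m C 2)
      -- Pascal's rule, with `suc m` read as `suc m C 1`.
      ≡⟨ ≡.cong (fromℕ 2 ^_) (≡.trans (≡.cong (ℕ._+ suc m C 2) (≡.sym (nC1≡n (suc m))))
           (nCk+nC[k+1]≡[n+1]C[k+1] (suc m) 1)) ⟩
    fromℕ 2 ^ (suc (suc m) C 2) ∎

  -- The double product runs over `0 ≤ j ≤ i < m`, so `y j` occurs once for each `i` from `j` to
  -- `m - 1`. The induction adds one row, which raises every exponent by one.
  product-triangle : ∀ m (y : ℕ → Carrier) →
    product {m} (λ i → product {suc (toℕ i)} (y ∘ toℕ)) ≈ product {m} (λ j → y (toℕ j) ^ (m ∸ toℕ j))
  product-triangle zero    y = refl
  product-triangle (suc m) y = begin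
    product {suc m} (λ i → row (suc (toℕ i)))
      ≈⟨ product-last m (row ∘ suc) ⟩
    product {m} (λ i → row (suc (toℕ i))) * row (suc m)
      ≈⟨ trans (*-comm _ _) (*-congˡ (product-triangle m y)) ⟩
    row (suc m) * product {m} (λ j → y (toℕ j) ^ (m ∸ toℕ j))
      -- The trivial factor `y m ^ 0` brings the product to the length of the new row.
      ≈⟨ *-congˡ (trans (*-congˡ (^-congʳ (y m) (ℕₚ.n∸n≡0 m))) (*-identityʳ _)) ⟨
    row (suc m) * (product {m} (λ j → y (toℕ j) ^ (m ∸ toℕ j)) * (y m ^ (m ∸ m)))
      ≈⟨ *-congˡ (product-last m (λ j → y j ^ (m ∸ j))) ⟨
    row (suc m) * product {suc m} (λ j → y (toℕ j) ^ (m ∸ toℕ j))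
      ≈⟨ product-distrib-* {suc m} (y ∘ toℕ) (λ j → y (toℕ j) ^ (m ∸ toℕ j)) ⟨
    product {suc m} (λ j → y (toℕ j) * (y (toℕ j) ^ (m ∸ toℕ j)))
      ≈⟨ product-cong {suc m} (λ j → ^-congʳ (y (toℕ j)) (ℕₚ.+-∸-assoc 1 (ℕ.s≤s⁻¹ (toℕ<n j)))) ⟨
    product {suc m} (λ j → y (toℕ j) ^ (suc m ∸ toℕ j)) ∎
    where
    row : ℕ → Carrier
    row n = product {n} (y ∘ toℕ)

  -- The determinant of f and its two closed forms.

  module _ (s : Carrier) where

    private
      t = ι ½ * s

    a-newton : ∀ i j → a s (2 ℕ.* i ℕ.+ j) ≈ a s (2 ℕ.* i) * newton (ratio s) (fromℕ (2 ℕ.* i)) j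
    a-newton i zero    = trans (reflexive (≡.cong (a s) (ℕₚ.+-identityʳ (2 ℕ.* i)))) (sym (*-identityʳ _))
    a-newton i (suc j) = begin
      a s (2 ℕ.* i ℕ.+ suc j)
        ≡⟨ ≡.cong (a s) (ℕₚ.+-suc (2 ℕ.* i) j) ⟩
      a s (suc (2 ℕ.* i ℕ.+ j))
        ≈⟨ a-suc s (2 ℕ.* i ℕ.+ j) ⟩
      ratio s (2 ℕ.* i ℕ.+ j) * a s (2 ℕ.* i ℕ.+ j)
        ≈⟨ *-cong (ratio-+ s i j) (a-newton i j) ⟩
      (fromℕ (2 ℕ.* i) + ratio s j) * (a s (2 ℕ.* i) * newton (ratio s) (fromℕ (2 ℕ.* i)) j)
        ≈⟨ solve 3 (λ r a n → r :* (a :* n) := a :* (r :* n)) refl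
             (fromℕ (2 ℕ.* i) + ratio s j) (a s (2 ℕ.* i)) (newton (ratio s) (fromℕ (2 ℕ.* i)) j) ⟩
      a s (2 ℕ.* i) * newton (ratio s) (fromℕ (2 ℕ.* i)) (suc j) ∎

    -- What index `k` contributes to the determinant: the row factor `a (2k)` times the Vandermonde
    -- factor `2^k k!`, with `k!` cancelled.
    diagonal : ℕ → Carrier
    diagonal k = fromℕ ((2 ℕ.* k) !) * ((fromℕ 2 ^ k) * pochhammer t k)

    a-even-! : ∀ k → a s (2 ℕ.* k) * ((fromℕ 2 ^ k) * fromℕ (k !)) ≈ diagonal k
    a-even-! k = begin
      a s (2 ℕ.* k) * (2^k * fromℕ (k !))
        ≈⟨ *-congʳ (trans (a-even s k) (*-congʳ (/!-fromℕ ((2 ℕ.* k) !) k))) ⟩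
      f * (1 /! k) * p * (2^k * fromℕ (k !))
        ≈⟨ solve 5 (λ f q p w m → f :* q :* p :* (w :* m) := m :* q :* (f :* (w :* p))) refl
             f (1 /! k) p 2^k (fromℕ (k !)) ⟩
      fromℕ (k !) * (1 /! k) * diagonal k
        ≈⟨ trans (*-congʳ (!*1/! k)) (*-identityˡ _) ⟩
      diagonal k ∎
      where
      f = fromℕ ((2 ℕ.* k) !)
      p = pochhammer t k
      2^k = fromℕ 2 ^ k

    Ḧ-diagonal : ∀ n → Ḧ n (fₛ s) ≈ product {n} (λ k → diagonal (toℕ k))
    Ḧ-diagonal n = begin
      det {n} (λ i j → a s (2 ℕ.* toℕ i ℕ.+ toℕ j))
        ≈⟨ det-cong {n} (λ i j → a-newton (toℕ i) (toℕ j)) ⟩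
      det {n} (λ i j → a s (2 ℕ.* toℕ i) * newton (ratio s) (fromℕ (2 ℕ.* toℕ i)) (toℕ j))
        ≈⟨ det-row-scale {n} (λ i → a s (2 ℕ.* toℕ i))
             (λ i j → newton (ratio s) (fromℕ (2 ℕ.* toℕ i)) (toℕ j)) ⟩
      product {n} (λ i → a s (2 ℕ.* toℕ i))
        * det {n} (λ i j → newton (ratio s) (fromℕ (2 ℕ.* toℕ i)) (toℕ j))
        ≈⟨ *-congˡ (det-newton-evens (ratio s) n (λ i → fromℕ (2 ℕ.* i)) 0#
             (λ i → sym (+-identityˡ _))) ⟩
      product {n} (λ i → a s (2 ℕ.* toℕ i))
        * product {n} (λ k → (fromℕ 2 ^ toℕ k) * fromℕ (toℕ k !))
        ≈⟨ product-distrib-* {n} (λ i → a s (2 ℕ.* toℕ i))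
             (λ k → (fromℕ 2 ^ toℕ k) * fromℕ (toℕ k !)) ⟨
      product {n} (λ k → a s (2 ℕ.* toℕ k) * ((fromℕ 2 ^ toℕ k) * fromℕ (toℕ k !)))
        ≈⟨ product-cong {n} (λ k → a-even-! (toℕ k)) ⟩
      product {n} (λ k → diagonal (toℕ k)) ∎

    -- The factor `diagonal 0` is 1, so the products may start at `k = 1`. Both closed forms are
    -- derived from this one.
    Ḧ-suc : ∀ m → Ḧ (suc m) (fₛ s) ≈
      ∏[1⋯ m ] (λ k → fromℕ ((2 ℕ.* k) !)) * ∏[1⋯ m ] (λ k → (fromℕ 2 ^ k) * pochhammer t k)
    Ḧ-suc m = begin
      Ḧ (suc m) (fₛ s)
        ≈⟨ Ḧ-diagonal (suc m) ⟩
      diagonal 0 * ∏[1⋯ m ] diagonal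
        ≈⟨ *-congʳ (trans (*-cong (+-identityʳ 1#) (*-identityˡ 1#)) (*-identityˡ 1#)) ⟩
      1# * ∏[1⋯ m ] diagonal
        ≈⟨ *-identityˡ _ ⟩
      ∏[1⋯ m ] diagonal
        ≈⟨ product-distrib-* {m} (λ i → fromℕ ((2 ℕ.* suc (toℕ i)) !))
             (λ i → (fromℕ 2 ^ suc (toℕ i)) * pochhammer t (suc (toℕ i))) ⟩
      ∏[1⋯ m ] (λ k → fromℕ ((2 ℕ.* k) !)) * ∏[1⋯ m ] (λ k → (fromℕ 2 ^ k) * pochhammer t k) ∎

    -- Each of the `k` factors `t + i` absorbs one 2, as `2 (s/2 + i) = s + 2i`.
    2^*pochhammer : ∀ k → (fromℕ 2 ^ k) * pochhammer t k ≈ product {k} (λ i → s + fromℕ (2 ℕ.* toℕ i))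
    2^*pochhammer zero    = *-identityˡ _
    2^*pochhammer (suc k) = begin
      (fromℕ 2 ^ suc k) * pochhammer t (suc k)
        ≈⟨ *-congˡ (pochhammer-suc t k) ⟩
      fromℕ 2 * (fromℕ 2 ^ k) * (pochhammer t k * (t + fromℕ k))
        ≈⟨ solve 4 (λ x w p y → x :* w :* (p :* y) := w :* p :* (x :* y)) refl
             (fromℕ 2) (fromℕ 2 ^ k) (pochhammer t k) (t + fromℕ k) ⟩
      (fromℕ 2 ^ k) * pochhammer t k * (fromℕ 2 * (t + fromℕ k))
        ≈⟨ *-cong (2^*pochhammer k) (2*[s/2+n] s k) ⟩
      product {k} (λ i → s + fromℕ (2 ℕ.* toℕ i)) * (s + fromℕ (2 ℕ.* k))
        ≈⟨ product-last k (λ i → s + fromℕ (2 ℕ.* i)) ⟨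
      product {suc k} (λ i → s + fromℕ (2 ℕ.* toℕ i)) ∎

    -- Passes from factors counted from `i = 0` to those counted from `j = i + 1`, as in the
    -- theorem.
    shift-by-2 : ∀ i → s + fromℕ (2 ℕ.* i) ≈ s + fromℕ (2 ℕ.* suc i) - fromℕ 2
    shift-by-2 i = sym (begin
      s + fromℕ (2 ℕ.* suc i) - fromℕ 2
        ≡⟨ ≡.cong (λ m → s + fromℕ m - fromℕ 2) (ℕₚ.*-suc 2 i) ⟩
      s + fromℕ (2 ℕ.+ 2 ℕ.* i) - fromℕ 2
        ≈⟨ +-congʳ (+-congˡ (fromℕ-+ 2 (2 ℕ.* i))) ⟩
      s + (fromℕ 2 + fromℕ (2 ℕ.* i)) - fromℕ 2
        ≈⟨ +-congʳ (solve 3 (λ s x y → s :+ (x :+ y) := x :+ (s :+ y)) refl s (fromℕ 2) _) ⟩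
      fromℕ 2 + (s + fromℕ (2 ℕ.* i)) - fromℕ 2
        ≈⟨ xyx⁻¹≈y _ _ ⟩
      s + fromℕ (2 ℕ.* i) ∎)

    scaled-pochhammers : ∀ m → ∏[1⋯ m ] (λ k → (fromℕ 2 ^ k) * pochhammer t k)
      ≈ ∏[1⋯ m ] (λ j → (s + fromℕ (2 ℕ.* j) - fromℕ 2) ^ (suc m ∸ j))
    scaled-pochhammers m = begin
      ∏[1⋯ m ] (λ k → (fromℕ 2 ^ k) * pochhammer t k)
        ≈⟨ product-cong {m} (λ i → 2^*pochhammer (suc (toℕ i))) ⟩
      product {m} (λ i → product {suc (toℕ i)} (y ∘ toℕ))
        ≈⟨ product-triangle m y ⟩
      product {m} (λ j → y (toℕ j) ^ (m ∸ toℕ j))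
        -- With `j` counted from 1 the exponent reads `suc m ∸ suc (toℕ j)`, which computes to
        -- `m ∸ toℕ j`.
        ≈⟨ product-cong {m} (λ j → ^-congˡ (m ∸ toℕ j) (shift-by-2 (toℕ j))) ⟩
      ∏[1⋯ m ] (λ j → (s + fromℕ (2 ℕ.* j) - fromℕ 2) ^ (suc m ∸ j)) ∎
      where
      y : ℕ → Carrier
      y i = s + fromℕ (2 ℕ.* i)

    Ḧ-powers : ∀ m → Ḧ (suc m) (fₛ s) ≈
      ∏[1⋯ m ] (λ k → fromℕ ((2 ℕ.* k) !))
        * ∏[1⋯ m ] (λ j → (s + fromℕ (2 ℕ.* j) - fromℕ 2) ^ (suc m ∸ j))
    Ḧ-powers m = trans (Ḧ-suc m) (*-congˡ (scaled-pochhammers m))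

    Ḧ-pochhammers : ∀ m → Ḧ (suc m) (fₛ s) ≈
      (fromℕ 2 ^ (suc m C 2)) * ∏[1⋯ m ] (λ k → fromℕ ((2 ℕ.* k) !)) * ∏[1⋯ m ] (pochhammer t)
    Ḧ-pochhammers m = begin
      Ḧ (suc m) (fₛ s)
        ≈⟨ Ḧ-suc m ⟩
      F * ∏[1⋯ m ] (λ k → (fromℕ 2 ^ k) * pochhammer t k)
        ≈⟨ *-congˡ (product-distrib-* {m} (λ i → fromℕ 2 ^ suc (toℕ i)) (λ i → pochhammer t (suc (toℕ i)))) ⟩
      F * (∏[1⋯ m ] (fromℕ 2 ^_) * ∏[1⋯ m ] (pochhammer t))
        ≈⟨ *-congˡ (*-congʳ (product-powers-of-2 m)) ⟩
      F * ((fromℕ 2 ^ (suc m C 2)) * ∏[1⋯ m ] (pochhammer t))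
        ≈⟨ trans (sym (*-assoc _ _ _)) (*-congʳ (*-comm _ _)) ⟩
      (fromℕ 2 ^ (suc m C 2)) * F * ∏[1⋯ m ] (pochhammer t) ∎
      where F = ∏[1⋯ m ] (λ k → fromℕ ((2 ℕ.* k) !))

theorem20p1 : ∀ {c ℓ : Level} (A : ℚ-Algebra c ℓ) →
    let open ℚ-Algebra A
        open Over A
    in
    ∀ (s : Carrier) →
    let a : ℕ → Carrier
        a = egfCoeff (fₛ s)
        s/2 : Carrier
        s/2 = ι ½ * s
    in
    (∀ k → a (2 ℕ.* k) ≈ ((2 ℕ.* k) ! /! k) * pochhammer s/2 k)
    × (∀ k → a (2 ℕ.* k ℕ.+ 1) ≈ fromℕ (2 ℕ.* k ℕ.+ 1) * a (2 ℕ.* k))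
    × (∀ n → n ≥ 1 →
        (Ḧ n (fₛ s)
          ≈ ∏[1⋯ n ∸ 1 ] (λ k → fromℕ ((2 ℕ.* k) !))
            * ∏[1⋯ n ∸ 1 ] (λ j → (s + fromℕ (2 ℕ.* j) - fromℕ 2) ^ (n ∸ j)))
        × (Ḧ n (fₛ s)
          ≈ (fromℕ 2 ^ (n C 2))
            * ∏[1⋯ n ∸ 1 ] (λ k → fromℕ ((2 ℕ.* k) !))
            * ∏[1⋯ n ∸ 1 ] (λ i → pochhammer s/2 i)))
theorem20p1 A s = a-even s , a-odd s , λ where (suc m) _ → Ḧ-powers s m , Ḧ-pochhammers s m
  where
  open Coefficients A
  open Hankel A
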